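{- Let $N$ be any positive integer. For the $N\times N\times N$ Latin cube over $\mathbb{Z}/N\mathbb{Z}$ formed by the Cayley addition table (the cube whose cells are indexed by the triples $(a,b,c)\in(\mathbb{Z}/N\mathbb{Z})^3$, the cell $(a,b,c)$ having entry $a+b+c$), each $n\times n\times n$ subcube with $1\le n\le N$ contains a Latin transversal.
   Context: An $n\times n\times n$ cube has cells indexed by triples of coordinates, each coordinate ranging over an index set of size $n$. A line of the cube is a set of $n$ cells obtained by fixing two of the three coordinates and letting the remaining one vary (analogous to a row or column of a matrix). A Latin cube over a set $S$ of cardinality $n$ is an $n\times n\times n$ cube whose entries come from $S$ and no line of which contains a repeated element. An $n\times n\times n$ subcube of an $N\times N\times N$ cube is obtained by restricting each of the three coordinates to a subset of size $n$ of its index set (the three subsets may be different); its lines are those of it regarded as an $n\times n\times n$ cube. A transversal of an $n\times n\times n$ cube is a collection of $n$ cells no two of which lie in the same line. A Latin transversal of a cube is a transversal whose cells contain no repeated element (i.e. the $n$ entries are pairwise distinct). -}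

module Defs where

open import Data.Nat.Base using (ℕ; _+_; _∸_; NonZero)
open import Data.Nat.Properties using (+-comm; +-assoc; m∸n+n≡m; <⇒≤)
open import Data.Nat.DivMod
  using (_%_; _mod_; m%n<n; m%n%n≡m%n; m<n⇒m%n≡m; [m+n]%n≡m%n; %-distribˡ-+)
open import Data.Fin.Base using (Fin; toℕ)
open import Data.Fin.Properties using (toℕ<n; toℕ-fromℕ<; toℕ-injective)
open import Data.Fin.Subset using (Subset; _∈_)
open import Data.Product.Base using (∃; _×_; _,_; proj₁)
open import Function.Base using (_∘_)
open import Function.Bundles using (_↔_)
open import Function.Construct.Identity using (↔-id)
open import Function.Definitions using (Injective)
open import Relation.Binary.PropositionalEquality
  using (_≡_; _≢_; refl; sym; trans; cong; module ≡-Reasoning)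
open import Relation.Nullary.Negation.Core using (¬_)

-- The three coordinates range over arbitrary sets I, J, K, so that a subcube
-- (whose coordinates range over three different subsets) is again a cube.

Cell : Set → Set → Set → Set
Cell I J K = I × J × K

Cube : Set → Set → Set → Set → Set
Cube I J K S = Cell I J K → S

-- A line is named by the two coordinates it fixes.
data Line (I J K : Set) : Set where
  fix₂₃ : J → K → Line I J K
  fix₁₃ : I → K → Line I J K
  fix₁₂ : I → J → Line I J K

module _ {I J K : Set} where

  infix 4 _liesOn_

  _liesOn_ : Cell I J K → Line I J K → Set
  (i , j , k) liesOn fix₂₃ j′ k′ = j ≡ j′ × k ≡ k′
  (i , j , k) liesOn fix₁₃ i′ k′ = i ≡ i′ × k ≡ k′
  (i , j , k) liesOn fix₁₂ i′ j′ = i ≡ i′ × j ≡ j′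

  SameLine : Cell I J K → Cell I J K → Set
  SameLine c d = ∃ λ (ℓ : Line I J K) → c liesOn ℓ × d liesOn ℓ

  record IsLatinCube {S : Set} (n : ℕ) (Q : Cube I J K S) : Set where
    field
      size₁       : I ↔ Fin n
      size₂       : J ↔ Fin n
      size₃       : K ↔ Fin n
      sizeEntries : S ↔ Fin n
      noRepeats   : ∀ (ℓ : Line I J K) {c d} → c liesOn ℓ → d liesOn ℓ →
                    Q c ≡ Q d → c ≡ d

  -- A collection of n cells is given by an enumeration.  Every cell shares a
  -- line with itself, so an enumeration satisfying this has no repetitions.
  IsTransversal : {n : ℕ} → (Fin n → Cell I J K) → Set
  IsTransversal {n} t = ∀ (p q : Fin n) → p ≢ q → ¬ SameLine (t p) (t q)

  record IsLatinTransversal {S : Set} {n : ℕ}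
         (Q : Cube I J K S) (t : Fin n → Cell I J K) : Set where
    field
      transversal     : IsTransversal t
      distinctEntries : Injective _≡_ _≡_ (Q ∘ t)

El : {N : ℕ} → Subset N → Set
El A = ∃ λ x → x ∈ A

subcube : {N : ℕ} {S : Set} → Cube (Fin N) (Fin N) (Fin N) S →
          (A B C : Subset N) → Cube (El A) (El B) (El C) S
subcube Q A B C (a , b , c) = Q (proj₁ a , proj₁ b , proj₁ c)

module _ {N : ℕ} .{{_ : NonZero N}} where

  infixl 6 _⊕_

  -- Addition in ℤ/Nℤ, the residue classes being represented by 0, …, N-1.
  _⊕_ : Fin N → Fin N → Fin N
  x ⊕ y = (toℕ x + toℕ y) mod N

  toℕ-⊕ : ∀ x y → toℕ (x ⊕ y) ≡ (toℕ x + toℕ y) % N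
  toℕ-⊕ x y = toℕ-fromℕ< (m%n<n (toℕ x + toℕ y) N)

  ⊕-comm : ∀ x y → x ⊕ y ≡ y ⊕ x
  ⊕-comm x y = cong (_mod N) (+-comm (toℕ x) (toℕ y))

  ⊕-cancelˡ : ∀ a {x y} → a ⊕ x ≡ a ⊕ y → x ≡ y
  ⊕-cancelˡ a {x} {y} eq = toℕ-injective
    (trans (sym (undo x)) (trans (cong (λ z → (N ∸ toℕ a + toℕ z) % N) eq) (undo y)))
    where
    open ≡-Reasoning
    undo : ∀ z → (N ∸ toℕ a + toℕ (a ⊕ z)) % N ≡ toℕ z
    undo z = let m = N ∸ toℕ a ; s = toℕ a + toℕ z in begin
      (m + toℕ (a ⊕ z)) % N        ≡⟨ cong (λ w → (m + w) % N) (toℕ-⊕ a z) ⟩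
      (m + s % N) % N              ≡⟨ %-distribˡ-+ m (s % N) N ⟩
      (m % N + s % N % N) % N      ≡⟨ cong (λ w → (m % N + w) % N) (m%n%n≡m%n s N) ⟩
      (m % N + s % N) % N          ≡⟨ %-distribˡ-+ m s N ⟨
      (m + s) % N                  ≡⟨ cong (_% N) (+-assoc m (toℕ a) (toℕ z)) ⟨
      (m + toℕ a + toℕ z) % N      ≡⟨ cong (λ w → (w + toℕ z) % N) (m∸n+n≡m (<⇒≤ (toℕ<n a))) ⟩
      (N + toℕ z) % N              ≡⟨ cong (_% N) (+-comm N (toℕ z)) ⟩
      (toℕ z + N) % N              ≡⟨ [m+n]%n≡m%n (toℕ z) N ⟩
      toℕ z % N                    ≡⟨ m<n⇒m%n≡m (toℕ<n z) ⟩
      toℕ z                        ∎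

  ⊕-cancelʳ : ∀ a {x y} → x ⊕ a ≡ y ⊕ a → x ≡ y
  ⊕-cancelʳ a {x} {y} eq =
    ⊕-cancelˡ a (trans (⊕-comm a x) (trans eq (⊕-comm y a)))

cayleyCube : (N : ℕ) .{{_ : NonZero N}} → Cube (Fin N) (Fin N) (Fin N) (Fin N)
cayleyCube N (a , b , c) = a ⊕ b ⊕ c

cayleyCube-isLatin : (N : ℕ) .{{_ : NonZero N}} → IsLatinCube N (cayleyCube N)
cayleyCube-isLatin N = record
  { size₁       = ↔-id (Fin N)
  ; size₂       = ↔-id (Fin N)
  ; size₃       = ↔-id (Fin N)
  ; sizeEntries = ↔-id (Fin N)
  ; noRepeats   = noRepeats
  }
  where
  noRepeats : ∀ (ℓ : Line (Fin N) (Fin N) (Fin N)) {c d} → c liesOn ℓ → d liesOn ℓ →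
              cayleyCube N c ≡ cayleyCube N d → c ≡ d
  noRepeats (fix₂₃ j k) (refl , refl) (refl , refl) eq =
    cong (_, j , k) (⊕-cancelʳ j (⊕-cancelʳ k eq))
  noRepeats (fix₁₃ i k) (refl , refl) (refl , refl) eq =
    cong (λ y → i , y , k) (⊕-cancelˡ i (⊕-cancelʳ k eq))
  noRepeats (fix₁₂ i j) (refl , refl) (refl , refl) eq =
    cong (λ z → i , j , z) (⊕-cancelˡ (i ⊕ j) eq)

{-# OPTIONS --safe #-}

-- Cells of a transversal need only differ in two of their three coordinates, and
-- for this a greedy choice succeeds in the subcube, which is an n × n × n cube
-- without repeated entries in its lines.  Put n = k + 1 and call an entry large
-- if it fills more than 3k cells.  A chosen cell shares a line with at most three
-- cells of any given entry, so large entries can safely be left to the end.  If only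
-- d < n entries are large, they fill at most d n² cells.  Choose n − d cells with
-- small entries first: a chosen cell excludes at most 3k + 1 cells on its lines and
-- 3k with its entry, and l (6k + 1) + d n² < n³ whenever l + d < n.
module Submission where

open import Defs
open import Data.Nat.Base
  using (ℕ; zero; suc; _+_; _*_; _∸_; _≤_; _≰_; _<_; z≤n; s≤s; NonZero)
open import Data.Nat.Properties
open import Data.Nat.Tactic.RingSolver using (solve-∀)
open import Data.Fin.Base using (Fin; zero; suc; punchIn; punchOut)
open import Data.Fin.Properties as Fin using (punchIn-punchOut; injective⇒≤)
open import Data.Fin.Subset using (Subset; ∣_∣; inside; outside)
open import Data.List.Base
  using (List; []; _∷_; _++_; length; lookup; map; concatMap; filter; take;
         allFin; cartesianProduct)
open import Data.List.Properties using (length-++; length-map; length-tabulate; length-take)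
open import Data.List.Membership.Propositional using (_∈_; _∉_; find; lose)
open import Data.List.Membership.Propositional.Properties
open import Data.List.Relation.Unary.All as All using (All; []; _∷_)
import Data.List.Relation.Unary.All.Properties as All
open import Data.List.Relation.Unary.Any as Any using (here; there)
open import Data.List.Relation.Unary.Any.Properties using (lookup-index)
open import Data.List.Relation.Unary.AllPairs using (AllPairs; []; _∷_)
open import Data.List.Relation.Unary.Unique.Propositional using (Unique)
import Data.List.Relation.Unary.Unique.Propositional.Properties as Unique
open import Data.Product.Base using (∃; _×_; _,_; proj₁; proj₂)
open import Data.Product.Properties using (≡-dec)
open import Data.Unit.Base using (tt)
open import Data.Vec.Base using ([]; _∷_; here; there)
open import Function.Base using (_∘_; id)
open import Function.Definitions using (Injective)
open import Relation.Binary.Definitions using (DecidableEquality; Symmetric)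
open import Relation.Binary.PropositionalEquality
open import Relation.Nullary using (Dec; yes; no; ¬_; ¬?; contradiction)
open import Relation.Nullary.Decidable using (_×-dec_)
open import Relation.Unary using (Decidable)

-- Counting in lists without repetitions.

module _ {A : Set} {R : A → A → Set} (R-sym : Symmetric R) where

  -- `AllPairs` relates earlier elements to later ones only; `R-sym` supplies the pairs with `j`
  -- before `i`.
  allPairs-lookup : ∀ {xs} → AllPairs R xs →
                    ∀ i j → i ≢ j → R (lookup xs i) (lookup xs j)
  allPairs-lookup (_ ∷ _)  zero    zero    i≢j = contradiction refl i≢j
  allPairs-lookup (r ∷ _)  zero    (suc j) _   = All.lookup r (∈-lookup j)
  allPairs-lookup (r ∷ _)  (suc i) zero    _   = R-sym (All.lookup r (∈-lookup i))
  allPairs-lookup (_ ∷ rs) (suc i) (suc j) i≢j = allPairs-lookup rs i j (i≢j ∘ cong suc)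

module _ {A B : Set} where

  -- Sending an index of `xs` to the position of its image in `ys` is an injection of index sets:
  -- equal positions force equal elements, and `xs` has no repetitions.
  length-≤-injection : ∀ {xs : List A} {ys : List B} (f : A → B) → Unique xs →
    (∀ {x} → x ∈ xs → f x ∈ ys) →
    (∀ {x y} → x ∈ xs → y ∈ xs → f x ≡ f y → x ≡ y) →
    length xs ≤ length ys
  length-≤-injection {xs} {ys} f uniq into inj = injective⇒≤ {f = position} position-injective
    where
    f∈ : ∀ i → f (lookup xs i) ∈ ys
    f∈ i = into (∈-lookup i)

    position : Fin (length xs) → Fin (length ys)
    position i = Any.index (f∈ i)

    position-injective : Injective _≡_ _≡_ position
    position-injective {i} {j} eq with i Fin.≟ j
    ... | yes i≡j = i≡j
    ... | no  i≢j = contradiction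
      (inj (∈-lookup i) (∈-lookup j)
        (trans (lookup-index (f∈ i)) (trans (cong (lookup ys) eq) (sym (lookup-index (f∈ j))))))
      (allPairs-lookup ≢-sym uniq i j i≢j)

  length-concatMap-≤ : ∀ (f : A → List B) {b xs} → All (λ x → length (f x) ≤ b) xs →
                       length (concatMap f xs) ≤ length xs * b
  length-concatMap-≤ f         []                 = z≤n
  length-concatMap-≤ f {b} {x ∷ xs} (fx≤b ∷ all) = begin
    length (f x ++ concatMap f xs)         ≡⟨ length-++ (f x) ⟩
    length (f x) + length (concatMap f xs) ≤⟨ +-mono-≤ fx≤b (length-concatMap-≤ f all) ⟩
    b + length xs * b                      ∎
    where open ≤-Reasoning

  length-cartesianProduct : ∀ (xs : List A) (ys : List B) →
                            length (cartesianProduct xs ys) ≡ length xs * length ys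
  length-cartesianProduct []       ys = refl
  length-cartesianProduct (x ∷ xs) ys =
    trans (length-++ (map (x ,_) ys))
          (cong₂ _+_ (length-map (x ,_) ys) (length-cartesianProduct xs ys))

length-allFin : ∀ n → length (allFin n) ≡ n
length-allFin n = length-tabulate id

length-subsingleton : ∀ {A : Set} {xs : List A} → Unique xs →
                      (∀ {x y} → x ∈ xs → y ∈ xs → x ≡ y) → length xs ≤ 1
length-subsingleton uniq sub =
  length-≤-injection {ys = tt ∷ []} (λ _ → tt) uniq (λ _ → here refl) (λ x∈ y∈ _ → sub x∈ y∈)

module _ {A : Set} (_≟_ : DecidableEquality A) where

  open import Data.List.Membership.DecPropositional _≟_ using (_∈?_)

  -- Pigeonhole: if every element of `xs` were in `ys`, the identity would inject `xs` into the
  -- shorter list. Both greedy steps find their next cell this way.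
  ∃∉ : ∀ {xs ys : List A} → Unique xs → length ys < length xs → ∃ λ x → x ∈ xs × x ∉ ys
  ∃∉ {xs} {ys} uniq ys<xs with Any.any? (λ x → ¬? (x ∈? ys)) xs
  ... | yes some = find some
  ... | no  none = contradiction (length-≤-injection id uniq into (λ _ _ → id)) (<⇒≱ ys<xs)
    where
    into : ∀ {x} → x ∈ xs → x ∈ ys
    into {x} x∈ with x ∈? ys
    ... | yes x∈ys = x∈ys
    ... | no  x∉ys = contradiction (lose x∈ x∉ys) none

-- Lines of a cube and reindexing of coordinates.

module _ {I J K : Set} where

  linesThrough : Cell I J K → List (Line I J K)
  linesThrough (i , j , k) = fix₂₃ j k ∷ fix₁₃ i k ∷ fix₁₂ i j ∷ []

  -- Turns a condition quantified over all lines into membership in a list of three, which can be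
  -- counted.
  sameLine⇒∈linesThrough : ∀ {c d : Cell I J K} → SameLine c d →
                           ∃ λ ℓ → ℓ ∈ linesThrough d × c liesOn ℓ
  sameLine⇒∈linesThrough (fix₂₃ _ _ , c∈ℓ , refl , refl) = _ , here refl , c∈ℓ
  sameLine⇒∈linesThrough (fix₁₃ _ _ , c∈ℓ , refl , refl) = _ , there (here refl) , c∈ℓ
  sameLine⇒∈linesThrough (fix₁₂ _ _ , c∈ℓ , refl , refl) = _ , there (there (here refl)) , c∈ℓ

  sameLine-sym : ∀ {c d : Cell I J K} → SameLine c d → SameLine d c
  sameLine-sym (ℓ , c∈ℓ , d∈ℓ) = ℓ , d∈ℓ , c∈ℓ

  -- Separated from `IsLatinCube` because it passes to subcubes, whereas a proper subcube is smaller
  -- than the set of entries.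
  NoRepeats : {S : Set} → Cube I J K S → Set
  NoRepeats Q = ∀ (ℓ : Line I J K) {c d} → c liesOn ℓ → d liesOn ℓ → Q c ≡ Q d → c ≡ d

module _ {I J K I′ J′ K′ : Set} (f : I → I′) (g : J → J′) (h : K → K′) where

  mapCell : Cell I J K → Cell I′ J′ K′
  mapCell (i , j , k) = f i , g j , h k

  mapLine : Line I J K → Line I′ J′ K′
  mapLine (fix₂₃ j k) = fix₂₃ (g j) (h k)
  mapLine (fix₁₃ i k) = fix₁₃ (f i) (h k)
  mapLine (fix₁₂ i j) = fix₁₂ (f i) (g j)

  liesOn-map : ∀ {c} ℓ → c liesOn ℓ → mapCell c liesOn mapLine ℓ
  liesOn-map (fix₂₃ _ _) (refl , refl) = refl , refl
  liesOn-map (fix₁₃ _ _) (refl , refl) = refl , refl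
  liesOn-map (fix₁₂ _ _) (refl , refl) = refl , refl

  module _ (f-inj : Injective _≡_ _≡_ f) (g-inj : Injective _≡_ _≡_ g)
           (h-inj : Injective _≡_ _≡_ h) where

    mapCell-injective : Injective _≡_ _≡_ mapCell
    mapCell-injective eq =
      cong₂ _,_ (f-inj (cong proj₁ eq))
        (cong₂ _,_ (g-inj (cong (proj₁ ∘ proj₂) eq)) (h-inj (cong (proj₂ ∘ proj₂) eq)))

    -- The parallel line through `c` serves: the fixed coordinates of the two images agree, so
    -- injectivity makes those of `c` and `d` agree.
    sameLine-reflect : ∀ {c d} → SameLine (mapCell c) (mapCell d) → SameLine c d
    sameLine-reflect {_ , j , k} (fix₂₃ _ _ , (p , q) , r , s) =
      fix₂₃ j k , (refl , refl) , g-inj (trans r (sym p)) , h-inj (trans s (sym q))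
    sameLine-reflect {i , _ , k} (fix₁₃ _ _ , (p , q) , r , s) =
      fix₁₃ i k , (refl , refl) , f-inj (trans r (sym p)) , h-inj (trans s (sym q))
    sameLine-reflect {i , j , _} (fix₁₂ _ _ , (p , q) , r , s) =
      fix₁₂ i j , (refl , refl) , f-inj (trans r (sym p)) , g-inj (trans s (sym q))

    noRepeats-restrict : ∀ {S : Set} {Q : Cube I′ J′ K′ S} → NoRepeats Q → NoRepeats (Q ∘ mapCell)
    noRepeats-restrict latin ℓ c∈ℓ d∈ℓ eq =
      mapCell-injective (latin (mapLine ℓ) (liesOn-map ℓ c∈ℓ) (liesOn-map ℓ d∈ℓ) eq)

-- For k ≥ 4 already 6k + 1 ≤ (k + 1)²; for smaller k the hypothesis l ≤ k is needed.
6k+1-bound : ∀ {k l} → l ≤ k → l * (1 + 6 * k) < (1 + l) * ((1 + k) * (1 + k))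
6k+1-bound {0} {0} _ = s≤s z≤n
6k+1-bound {1} {l} l≤1 with l | l≤1
... | 0 | _ = s≤s z≤n
-- In the numerical cases the first argument of `m≤m+n` is the left side plus one and the second is
-- the slack, which vanishes at `k = l = 1` and `k = l = 2`.
... | 1 | _ = m≤m+n 8 0
... | suc (suc _) | s≤s ()
6k+1-bound {2} {l} l≤2 with l | l≤2
... | 0 | _ = m≤m+n 1 8
... | 1 | _ = m≤m+n 14 4
... | 2 | _ = m≤m+n 27 0
... | suc (suc (suc _)) | s≤s (s≤s ())
6k+1-bound {3} {l} l≤3 with l | l≤3
... | 0 | _ = m≤m+n 1 15
... | 1 | _ = m≤m+n 20 12
... | 2 | _ = m≤m+n 39 9
... | 3 | _ = m≤m+n 58 6
... | suc (suc (suc (suc _))) | s≤s (s≤s (s≤s ()))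
6k+1-bound {suc (suc (suc (suc m)))} {l} _ = begin-strict
  l * (1 + 6 * k)             ≤⟨ *-monoʳ-≤ l (m≤m+n (1 + 6 * k) (m * m + 4 * m)) ⟩
  l * (1 + 6 * k + (m * m + 4 * m)) ≡⟨ cong (l *_) (square m) ⟩
  l * ((1 + k) * (1 + k))     <⟨ m<n+m _ {(1 + k) * (1 + k)} (s≤s z≤n) ⟩
  (1 + l) * ((1 + k) * (1 + k)) ∎
  where
  open ≤-Reasoning
  k = 4 + m
  square : ∀ m → 1 + 6 * (4 + m) + (m * m + 4 * m) ≡ (5 + m) * (5 + m)
  square = solve-∀

-- Cells grouped by their entry.

module Greedy {k N : ℕ} (Q : Cube (Fin (suc k)) (Fin (suc k)) (Fin (suc k)) (Fin N))
              (noRepeats : NoRepeats Q) where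

  private
    n = suc k

    C : Set
    C = Cell (Fin n) (Fin n) (Fin n)

    L : Set
    L = Line (Fin n) (Fin n) (Fin n)

  _≟ᶜ_ : DecidableEquality C
  _≟ᶜ_ = ≡-dec Fin._≟_ (≡-dec Fin._≟_ Fin._≟_)

  _liesOn?_ : (c : C) (ℓ : L) → Dec (c liesOn ℓ)
  (i , j , k) liesOn? fix₂₃ j′ k′ = (j Fin.≟ j′) ×-dec (k Fin.≟ k′)
  (i , j , k) liesOn? fix₁₃ i′ k′ = (i Fin.≟ i′) ×-dec (k Fin.≟ k′)
  (i , j , k) liesOn? fix₁₂ i′ j′ = (i Fin.≟ i′) ×-dec (j Fin.≟ j′)

  Compatible : C → C → Set
  Compatible c d = ¬ SameLine c d × Q c ≢ Q d

  compatible-sym : Symmetric Compatible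
  compatible-sym (c≁d , Qc≢Qd) = c≁d ∘ sameLine-sym , ≢-sym Qc≢Qd

  square : List (Fin n × Fin n)
  square = cartesianProduct (allFin n) (allFin n)

  cells : List C
  cells = cartesianProduct (allFin n) square

  ∈-cells : ∀ c → c ∈ cells
  ∈-cells (i , j , k) =
    ∈-cartesianProduct⁺ (∈-allFin i) (∈-cartesianProduct⁺ (∈-allFin j) (∈-allFin k))

  cells-unique : Unique cells
  cells-unique =
    Unique.cartesianProduct⁺ (Unique.allFin⁺ n)
      (Unique.cartesianProduct⁺ (Unique.allFin⁺ n) (Unique.allFin⁺ n))

  length-square : length square ≡ n * n
  length-square = trans (length-cartesianProduct (allFin n) (allFin n))
                        (cong₂ _*_ (length-allFin n) (length-allFin n))

  length-cells : length cells ≡ n * (n * n)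
  length-cells = trans (length-cartesianProduct (allFin n) square)
                       (cong₂ _*_ (length-allFin n) length-square)

  layer : Fin N → List C
  layer s = filter (λ c → Q c Fin.≟ s) cells

  ∈-layer : ∀ c → c ∈ layer (Q c)
  ∈-layer c = ∈-filter⁺ (λ c → Q c Fin.≟ _) (∈-cells c) refl

  layer⇒≡ : ∀ {s c} → c ∈ layer s → Q c ≡ s
  layer⇒≡ {s} c∈ = proj₂ (∈-filter⁻ (λ c → Q c Fin.≟ s) {xs = cells} c∈)

  layer-unique : ∀ s → Unique (layer s)
  layer-unique s = Unique.filter⁺ (λ c → Q c Fin.≟ s) cells-unique

  -- A line in the third direction meets a layer at most once, so forgetting the third coordinate is
  -- injective on the layer.
  length-layer≤ : ∀ s → length (layer s) ≤ n * n
  length-layer≤ s = subst (length (layer s) ≤_) length-square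
    (length-≤-injection proj₁₂ (layer-unique s)
      (λ { {i , j , _} _ → ∈-cartesianProduct⁺ (∈-allFin i) (∈-allFin j) }) inj)
    where
    proj₁₂ : C → Fin n × Fin n
    proj₁₂ (i , j , _) = i , j

    inj : ∀ {c d} → c ∈ layer s → d ∈ layer s → proj₁₂ c ≡ proj₁₂ d → c ≡ d
    inj {i , j , _} c∈ d∈ refl =
      noRepeats (fix₁₂ i j) (refl , refl) (refl , refl) (trans (layer⇒≡ c∈) (sym (layer⇒≡ d∈)))

  -- Adding cells with large entries.

  Large : Fin N → Set
  Large s = 3 * k < length (layer s)

  large? : Decidable Large
  large? s = 3 * k <? length (layer s)

  module LargeStep {s : Fin N} (large : Large s) (T : List C) (T≤k : length T ≤ k) where

    lines : List L
    lines = concatMap linesThrough T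

    layerOn : L → List C
    layerOn ℓ = filter (_liesOn? ℓ) (layer s)

    length-layerOn≤1 : ∀ ℓ → length (layerOn ℓ) ≤ 1
    length-layerOn≤1 ℓ = length-subsingleton (Unique.filter⁺ (_liesOn? ℓ) (layer-unique s)) sub
      where
      sub : ∀ {c d} → c ∈ layerOn ℓ → d ∈ layerOn ℓ → c ≡ d
      sub c∈ d∈ with ∈-filter⁻ (_liesOn? ℓ) {xs = layer s} c∈ | ∈-filter⁻ (_liesOn? ℓ) {xs = layer s} d∈
      ... | c∈s , c∈ℓ | d∈s , d∈ℓ = noRepeats ℓ c∈ℓ d∈ℓ (trans (layer⇒≡ c∈s) (sym (layer⇒≡ d∈s)))

    excluded : List C
    excluded = concatMap layerOn lines

    -- At most `k` chosen cells have at most `3 * k` lines through them, each meeting the layer at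
    -- most once; largeness leaves a cell over.
    length-excluded : length excluded < length (layer s)
    length-excluded = begin-strict
      length excluded                         ≤⟨ length-concatMap-≤ layerOn (All.universal length-layerOn≤1 lines) ⟩
      length lines * 1   ≡⟨ *-identityʳ _ ⟩
      length lines       ≤⟨ length-concatMap-≤ linesThrough (All.universal (λ _ → ≤-refl) T) ⟩
      length T * 3                            ≤⟨ *-monoˡ-≤ 3 T≤k ⟩
      k * 3                                   ≡⟨ *-comm k 3 ⟩
      3 * k                                   <⟨ large ⟩
      length (layer s)                        ∎
      where open ≤-Reasoning

    choose : ∃ λ c → Q c ≡ s × All (λ t → ¬ SameLine c t) T
    choose with ∃∉ _≟ᶜ_ (layer-unique s) length-excluded
    ... | c , c∈s , c∉ = c , layer⇒≡ c∈s , All.tabulate notSame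
      where
      notSame : ∀ {t} → t ∈ T → ¬ SameLine c t
      notSame t∈ same with sameLine⇒∈linesThrough same
      ... | ℓ , ℓ∈ , c∈ℓ =
        c∉ (∈-concatMap⁺ layerOn (lose (∈-concatMap⁺ linesThrough (lose t∈ ℓ∈))
                                       (∈-filter⁺ (_liesOn? ℓ) c∈s c∈ℓ)))

  -- One cell is added for each entry of `D`. The entries of `T` stay disjoint from what remains of
  -- `D`, so each new entry is fresh and only lines need avoiding.
  extendByLarge : ∀ {D T} → Unique D → All Large D → AllPairs Compatible T →
    All (λ t → Q t ∉ D) T → length D + length T ≤ n →
    ∃ λ T′ → AllPairs Compatible T′ × length T′ ≡ length D + length T
  extendByLarge {[]} {T} _ _ compat _ _ = T , compat , refl
  extendByLarge {s ∷ D} {T} (s∉D ∷ uniq) (large ∷ larges) compat disjoint bound =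
    -- Since `s` still awaits its cell, the bound by `n` leaves at most `k` cells in `T`.
    let c , Qc≡s , notSame = LargeStep.choose large T (≤-trans (m≤n+m _ (length D)) (≤-pred bound))
        T′ , compat′ , eq  = extendByLarge {D} {c ∷ T} uniq larges
          (All.tabulate (λ t∈ → All.lookup notSame t∈
                             , λ Qc≡Qt → All.lookup disjoint t∈ (here (trans (sym Qc≡Qt) Qc≡s)))
            ∷ compat)
          ((λ Qc∈D → All.lookup s∉D Qc∈D (sym Qc≡s)) ∷ All.map (_∘ there) disjoint)
          (subst (_≤ n) (sym (+-suc (length D) (length T))) bound)
    in T′ , compat′ , trans eq (+-suc (length D) (length T))

  -- Adding cells with small entries.

  module SmallStep {D : List (Fin N)} (all-large : ∀ {s} → Large s → s ∈ D)
                   (T : List C) (small : All (¬_ ∘ Large ∘ Q) T)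
                   (T+D<n : length T + length D < n) where

    -- The three lines through a cell have 3k + 1 cells; punchIn keeps the cell itself
    -- from being counted three times, as 3k + 3 would be too many when k = 1.
    mates₁ mates₂ mates₃ lineMates : C → List C
    mates₁ (i , j , l) = map (λ x → x , j , l) (allFin n)
    mates₂ (i , j , l) = map (λ y → i , punchIn j y , l) (allFin k)
    mates₃ (i , j , l) = map (λ z → i , j , punchIn l z) (allFin k)
    lineMates c = mates₁ c ++ mates₂ c ++ mates₃ c

    length-lineMates : ∀ c → length (lineMates c) ≡ 1 + 3 * k
    length-lineMates c = begin
      length (lineMates c)
        ≡⟨ length-++ (mates₁ c) ⟩
      length (mates₁ c) + length (mates₂ c ++ mates₃ c)
        ≡⟨ cong (length (mates₁ c) +_) (length-++ (mates₂ c)) ⟩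
      length (mates₁ c) + (length (mates₂ c) + length (mates₃ c))
        ≡⟨ cong₂ _+_ (len n) (cong₂ _+_ (len k) (len k)) ⟩
      n + (k + k)
        ≡⟨ cong (λ m → n + (k + m)) (+-identityʳ k) ⟨
      1 + 3 * k
        ∎
      where
      open ≡-Reasoning
      len : ∀ m {f : Fin m → C} → length (map f (allFin m)) ≡ m
      len m {f} = trans (length-map f (allFin m)) (length-allFin m)

    self∈mates₁ : ∀ c → c ∈ mates₁ c
    self∈mates₁ (i , j , l) = ∈-map⁺ (λ x → x , j , l) (∈-allFin i)

    sameLine⇒∈lineMates : ∀ {c d} → SameLine c d → c ∈ lineMates d
    sameLine⇒∈lineMates {x , _} {i , j , l} (fix₂₃ _ _ , (refl , refl) , refl , refl) =
      ∈-++⁺ˡ (∈-map⁺ (λ x → x , j , l) (∈-allFin x))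
    sameLine⇒∈lineMates {_ , y , _} {d@(i , j , l)} (fix₁₃ _ _ , (refl , refl) , refl , refl)
      with j Fin.≟ y
    ... | yes refl = ∈-++⁺ˡ (self∈mates₁ d)
    ... | no  j≢y  = ∈-++⁺ʳ (mates₁ d) (∈-++⁺ˡ
      (subst (λ y → (i , y , l) ∈ mates₂ d) (punchIn-punchOut j≢y)
        (∈-map⁺ (λ y → i , punchIn j y , l) (∈-allFin (punchOut j≢y)))))
    sameLine⇒∈lineMates {_ , _ , z} {d@(i , j , l)} (fix₁₂ _ _ , (refl , refl) , refl , refl)
      with l Fin.≟ z
    ... | yes refl = ∈-++⁺ˡ (self∈mates₁ d)
    ... | no  l≢z  = ∈-++⁺ʳ (mates₁ d) (∈-++⁺ʳ (mates₂ d)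
      (subst (λ z → (i , j , z) ∈ mates₃ d) (punchIn-punchOut l≢z)
        (∈-map⁺ (λ z → i , j , punchIn l z) (∈-allFin (punchOut l≢z)))))

    conflicts : C → List C
    conflicts t = lineMates t ++ layer (Q t)

    -- The cell `t` is counted in both parts of `conflicts t`; the arithmetic bound can afford this.
    length-conflicts : ∀ {t} → ¬ Large (Q t) → length (conflicts t) ≤ 1 + 6 * k
    length-conflicts {t} ¬large = begin
      length (conflicts t)                        ≡⟨ length-++ (lineMates t) ⟩
      length (lineMates t) + length (layer (Q t)) ≤⟨ +-mono-≤ (≤-reflexive (length-lineMates t)) (≮⇒≥ ¬large) ⟩
      1 + 3 * k + 3 * k                           ≡⟨ cong suc (*-distribʳ-+ k 3 3) ⟨
      1 + 6 * k                                   ∎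
      where open ≤-Reasoning

    excluded : List C
    excluded = concatMap conflicts T ++ concatMap layer D

    length-excluded : length excluded < length cells
    length-excluded = begin-strict
      length excluded
        ≡⟨ length-++ (concatMap conflicts T) ⟩
      length (concatMap conflicts T) + length (concatMap layer D)
        ≤⟨ +-mono-≤ (length-concatMap-≤ conflicts (All.map length-conflicts small))
                    (length-concatMap-≤ layer (All.universal length-layer≤ D)) ⟩
      length T * (1 + 6 * k) + length D * (n * n)
        -- The conflicts of `T` cost less than `1 + length T` blocks of size `n * n`; with one block
        -- per entry of `D` this makes at most `n` blocks, the whole cube.
        <⟨ +-monoˡ-< (length D * (n * n)) (6k+1-bound (m+n≤o⇒m≤o (length T) (≤-pred T+D<n))) ⟩
      (1 + length T) * (n * n) + length D * (n * n)
        ≡⟨ *-distribʳ-+ (n * n) (1 + length T) (length D) ⟨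
      (1 + length T + length D) * (n * n)
        ≤⟨ *-monoˡ-≤ (n * n) T+D<n ⟩
      n * (n * n)
        ≡⟨ length-cells ⟨
      length cells
        ∎
      where open ≤-Reasoning

    choose : ∃ λ c → ¬ Large (Q c) × All (Compatible c) T
    choose with ∃∉ _≟ᶜ_ cells-unique length-excluded
    ... | c , _ , c∉ = c , ¬large , All.tabulate compat
      where
      ¬large : ¬ Large (Q c)
      ¬large large = c∉ (∈-++⁺ʳ (concatMap conflicts T)
        (∈-concatMap⁺ layer (lose (all-large large) (∈-layer c))))

      ∉conflicts : ∀ {t} → t ∈ T → c ∉ conflicts t
      ∉conflicts t∈ c∈ = c∉ (∈-++⁺ˡ (∈-concatMap⁺ conflicts (lose t∈ c∈)))

      compat : ∀ {t} → t ∈ T → Compatible c t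
      compat {t} t∈ =
        (λ same → ∉conflicts t∈ (∈-++⁺ˡ (sameLine⇒∈lineMates same))) ,
        (λ Qc≡Qt → ∉conflicts t∈ (∈-++⁺ʳ (lineMates t) (subst (λ s → c ∈ layer s) Qc≡Qt (∈-layer c))))

  chooseSmall : ∀ {D} → (∀ {s} → Large s → s ∈ D) → ∀ m → m + length D ≤ n →
    ∃ λ T → length T ≡ m × AllPairs Compatible T × All (¬_ ∘ Large ∘ Q) T
  chooseSmall all-large zero    _     = [] , refl , [] , []
  -- The same `bound` serves weakened in the recursive call and as the strict inequality that
  -- `SmallStep` requires.
  chooseSmall {D} all-large (suc m) bound = grow (chooseSmall all-large m (<⇒≤ bound))
    where
    grow : (∃ λ T → length T ≡ m × AllPairs Compatible T × All (¬_ ∘ Large ∘ Q) T) →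
           ∃ λ T → length T ≡ suc m × AllPairs Compatible T × All (¬_ ∘ Large ∘ Q) T
    grow (T , T≡m , compat , small) =
      let c , ¬large , c-compat = SmallStep.choose all-large T small
                                    (subst (λ l → l + length D < n) (sym T≡m) bound)
      in c ∷ T , cong suc T≡m , c-compat ∷ compat , ¬large ∷ small

  -- Combining the two phases.

  compatibleCells : ∃ λ T → AllPairs Compatible T × length T ≡ n
  compatibleCells = choose (n ≤? length D)
    where
    D : List (Fin N)
    D = filter large? (allFin N)

    D-unique : Unique D
    D-unique = Unique.filter⁺ large? (Unique.allFin⁺ N)

    D-large : All Large D
    D-large = All.all-filter large? (allFin N)

    truncated : n ≤ length D → length (take n D) + 0 ≡ n
    truncated n≤D = trans (+-identityʳ _) (trans (length-take n D) (m≤n⇒m⊓n≡m n≤D))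

    total : n ≰ length D → ∀ {m} → m ≡ n ∸ length D → length D + m ≡ n
    total n≰D refl = m+[n∸m]≡n (≰⇒≥ n≰D)

    choose : Dec (n ≤ length D) → ∃ λ T → AllPairs Compatible T × length T ≡ n
    -- With enough large entries no small one is required; `n` of them are kept so that exactly `n`
    -- cells result.
    choose (yes n≤D) =
      let T , compat , eq = extendByLarge {take n D} {[]}
            (Unique.take⁺ n D-unique) (All.take⁺ n D-large) [] [] (≤-reflexive (truncated n≤D))
      in T , compat , trans eq (truncated n≤D)
    choose (no n≰D) =
      let T , T≡n∸D , compat , small =
            chooseSmall (∈-filter⁺ large? (∈-allFin _)) (n ∸ length D)
              (≤-reflexive (m∸n+n≡m (≰⇒≥ n≰D)))
          T′ , compat′ , eq = extendByLarge {D} {T} D-unique D-large compat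
            -- Every entry in `D` is large, so the entries of the small cells avoid `D`.
            (All.map (λ ¬large Qt∈D → ¬large (All.lookup D-large Qt∈D)) small)
            (≤-reflexive (total n≰D T≡n∸D))
      in T′ , compat′ , trans eq (total n≰D T≡n∸D)

  latinTransversal : ∃ λ (t : Fin n → C) → IsLatinTransversal Q t
  latinTransversal with compatibleCells
  ... | T , compat , T≡n = subst (λ m → ∃ λ (t : Fin m → C) → IsLatinTransversal Q t) T≡n
    (lookup T , record
      { transversal     = λ p q p≢q → proj₁ (allPairs-lookup compatible-sym compat p q p≢q)
      ; distinctEntries = λ {p} {q} → distinct p q
      })
    where
    distinct : ∀ p q → Q (lookup T p) ≡ Q (lookup T q) → p ≡ q
    distinct p q eq with p Fin.≟ q
    ... | yes p≡q = p≡q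
    ... | no  p≢q = contradiction eq (proj₂ (allPairs-lookup compatible-sym compat p q p≢q))

-- Transfer to subcubes of the Cayley cube.

-- Injectivity is stated after forgetting the membership proof, as restricting the Cayley cube
-- requires; injectivity into `El A` follows.
enumerate : ∀ {N} (A : Subset N) → ∃ λ (f : Fin ∣ A ∣ → El A) → Injective _≡_ _≡_ (proj₁ ∘ f)
enumerate []            = (λ ()) , λ {}
enumerate (outside ∷ A) with enumerate A
... | f , f-inj = (λ i → suc (proj₁ (f i)) , there (proj₂ (f i))) , f-inj ∘ Fin.suc-injective
enumerate (inside ∷ A) with enumerate A
... | f , f-inj = g , g-inj
  where
  g : Fin (suc ∣ A ∣) → El (inside ∷ A)
  g zero    = zero , here
  g (suc i) = suc (proj₁ (f i)) , there (proj₂ (f i))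

  g-inj : Injective _≡_ _≡_ (proj₁ ∘ g)
  g-inj {zero}  {zero}  _  = refl
  g-inj {suc i} {suc j} eq = cong suc (f-inj (Fin.suc-injective eq))

corollary1p1 : (N : ℕ) .{{_ : NonZero N}} (n : ℕ) → 1 ≤ n → n ≤ N →
    (A B C : Subset N) → ∣ A ∣ ≡ n → ∣ B ∣ ≡ n → ∣ C ∣ ≡ n →
    ∃ λ (t : Fin n → Cell (El A) (El B) (El C)) →
    IsLatinTransversal (subcube (cayleyCube N) A B C) t
corollary1p1 N (suc k) _ _ A B C ∣A∣≡n ∣B∣≡n ∣C∣≡n
  with subst (λ m → ∃ λ (f : Fin m → El A) → Injective _≡_ _≡_ (proj₁ ∘ f)) ∣A∣≡n (enumerate A)
     | subst (λ m → ∃ λ (f : Fin m → El B) → Injective _≡_ _≡_ (proj₁ ∘ f)) ∣B∣≡n (enumerate B)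
     | subst (λ m → ∃ λ (f : Fin m → El C) → Injective _≡_ _≡_ (proj₁ ∘ f)) ∣C∣≡n (enumerate C)
... | a , a-inj | b , b-inj | c , c-inj
  with Greedy.latinTransversal
         (subcube (cayleyCube N) A B C ∘ mapCell a b c)
         -- The reindexed subcube is by definition the Cayley cube restricted along these three
         -- maps.
         (noRepeats-restrict (proj₁ ∘ a) (proj₁ ∘ b) (proj₁ ∘ c) a-inj b-inj c-inj
           (IsLatinCube.noRepeats (cayleyCube-isLatin N)))
... | t , t-latin = mapCell a b c ∘ t , record
  { transversal     = λ p q p≢q → transversal p q p≢q ∘ sameLine-reflect a b c
                        (a-inj ∘ cong proj₁) (b-inj ∘ cong proj₁) (c-inj ∘ cong proj₁)
  ; distinctEntries = distinctEntries
  }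
  where open IsLatinTransversal t-latin
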